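{- The limit $\overline K=\lim_{n\to\infty}\frac{\overline K(n)}{n}$ exists, is equal to $\inf_{n\ge 1}\frac{\overline K(n)}{n}$, and satisfies \[0.08781<\overline K\le \frac{\overline K(21)}{21}=\frac{372487}{7\cdot 2^{18}}\approx 0.2030 .\]
   Context: Words are finite strings over the two-letter alphabet $\{a,b\}$; the length of a word $w$ is $l(w)$. A word $w=a_0\dots a_n$ is a palindrome if $a_i=a_{n-i}$ for all $i\le n$. For a nonempty word $w$, $m(w)$ is the minimal number $k$ such that $w=p_1\cdots p_k$ (concatenation) with $p_1,\dots,p_k$ nonempty palindromes. For a positive integer $n$, $\overline K(n)=2^{ -n}\sum\{m(w): l(w)=n\}$, the average of $m(w)$ over all $2^n$ binary words of length $n$. -}

module Defs where

open import Data.Bool using (Bool; true; false; _≟_)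
open import Data.List using (List; []; _∷_; reverse; length; map; concatMap; filter; foldr; _++_)
open import Data.Nat.ListAction using (sum)
open import Data.List.Properties using (≡-dec)
open import Data.List.Relation.Unary.All using (All)
open import Data.List.Relation.Unary.All using (all?)
open import Data.Nat using (ℕ; zero; suc; _*_; _^_; _⊓_; NonZero)
open import Data.Nat.Properties using (m*n≢0; m^n≢0)
open import Data.Integer using (+_)
open import Data.Rational using (ℚ; _/_)
open import Relation.Binary.PropositionalEquality using (_≡_)
open import Relation.Nullary.Decidable using (Dec; does)

-- Words over {a,b}: a ↦ false, b ↦ true.
Word : Set
Word = List Bool

IsPalindrome : Word → Set
IsPalindrome w = w ≡ reverse w

isPalindrome? : (w : Word) → Dec (IsPalindrome w)
isPalindrome? w = ≡-dec _≟_ w (reverse w)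

factorizations : Word → List (List Word)
factorizations [] = [] ∷ []
factorizations (x ∷ xs) = concatMap step (factorizations xs)
  where
  step : List Word → List (List Word)
  step [] = ((x ∷ []) ∷ []) ∷ []
  step (p ∷ ps) = ((x ∷ []) ∷ p ∷ ps) ∷ ((x ∷ p) ∷ ps) ∷ []

palFactorizations : Word → List (List Word)
palFactorizations w = filter (all? isPalindrome?) (factorizations w)

-- m(w): minimal number of nonempty palindromes whose concatenation is w.
-- (Minimum of the lengths of all palindromic factorizations; the default
-- value l(w) of the fold is attained by the factorization into letters,
-- so this is exactly the minimum for nonempty w.)
m : Word → ℕ
m w = foldr (λ f r → length f ⊓ r) (length w) (palFactorizations w)

wordsOfLength : ℕ → List Word
wordsOfLength zero = [] ∷ []
wordsOfLength (suc n) = map (false ∷_) (wordsOfLength n) ++ map (true ∷_) (wordsOfLength n)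

sumM : ℕ → ℕ
sumM n = sum (map m (wordsOfLength n))

-- K̄(n)/n = 2^{-n} Σ_{l(w)=n} m(w) / n, as a rational, for n ≥ 1
Kratio : (n : ℕ) → .{{NonZero n}} → ℚ
Kratio n {{nz}} = (+ sumM n) / (n * 2 ^ n)
  where instance
    _ : NonZero (n * 2 ^ n)
    _ = m*n≢0 n (2 ^ n) {{nz}} {{m^n≢0 2 n}}

{-# OPTIONS --safe #-}
module Submission where

-- Limit.  Cutting a word u ++ v breaks at most one palindrome of an optimal
-- factorization, and palindromes s ++ r across the cut are so rare in random
-- words that splitting the broken one into letters costs at most 288 on
-- average.  Hence K̄ is subadditive and, up to 288, superadditive; comparing
-- both K̄(n)/n and K̄(k)/k with K̄(kn)/(kn) gives K̄(n)/n ≤ K̄(k)/k + 288/n.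
--
-- Lower bound.  Splitting off the first palindrome shows by induction that
-- Σ 20^(−m(w)) ≤ (3/2)ⁿ over the words of length n.  By convexity of 20^(−x)
-- and 20·(3/4)¹¹ < 1, this forces K̄(11n) ≥ n, so K̄(n)/n ≥ 1/11 > 0.08781
-- by subadditivity.
--
-- K̄(21).  sumM 21 is evaluated by a search over all words, each step of which
-- prepends a letter c to s and keeps the remainders of s, i.e. all t with
-- s = p ++ t for a palindrome p.  The nonempty palindromic prefixes of c ∷ s
-- are [ c ] and the c ∷ q ∷ʳ c with q a palindrome and s = q ++ c ∷ t.

open import Defs
open import Data.Nat using (ℕ; NonZero; _≥_; _*_; _^_)
open import Data.Rational using (ℚ; _/_; 0ℚ)
open import Data.Product using (_×_; ∃; _,_)
open import Relation.Binary.PropositionalEquality using (_≡_)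

module PalindromicLength where
  open import Data.Bool using (Bool; true; false; if_then_else_)
  open import Data.Integer using (-[1+_])
  import Data.Integer as ℤ using (+_; _+_; _*_; _≤_; +≤+; +<+)
  import Data.Integer.Properties as ℤ using (pos-*)
  open import Data.List using (List; []; _∷_; _∷ʳ_; _++_; [_]; length; map; reverse; concat; foldr; initLast; _∷ʳ′_)
  open import Data.List.Properties using (map-++; map-∘; unfold-reverse; reverse-++; ++-assoc; ++-identityʳ; length-++; length-++-≤ˡ; ∷-injectiveˡ; ∷-injectiveʳ; ∷ʳ-++; ∷ʳ-injectiveˡ)
  open import Data.List.Membership.Propositional using (_∈_; lose; find)
  open import Data.List.Membership.Propositional.Properties using (∈-map⁺; ∈-map⁻; ∈-concatMap⁺; ∈-concatMap⁻; ∈-filter⁺; ∈-filter⁻)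
  open import Data.List.Relation.Unary.All using (All; []; _∷_; all?)
  open import Data.List.Relation.Unary.Any using (here; there)
  open import Data.Nat using (zero; suc; pred; _+_; _∸_; _⊓_; _⊓′_; _<ᵇ_; ⌈_/2⌉; _≤_; z≤n; s≤s)
  open import Data.Nat.ListAction using (sum)
  open import Data.Nat.ListAction.Properties using (sum-++)
  open import Data.Nat.Properties
  open import Data.Nat.Solver using (module +-*-Solver)
  open import Data.Product using (proj₁; proj₂)
  open import Data.Rational using (mkℚ; toℚᵘ)
  import Data.Rational as ℚ using (_+_; _≤_; _<_; *<*)
  import Data.Rational.Properties as ℚ using (toℚᵘ-cancel-≤; toℚᵘ-fromℚᵘ; toℚᵘ-homo-+; ↥p/↧p≡p; ≤-trans; ≤-reflexive; +-identityʳ)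
  open import Data.Rational.Unnormalised using (mkℚᵘ; *≤*)
  import Data.Rational.Unnormalised as ℚᵘ using (_+_)
  import Data.Rational.Unnormalised.Properties as ℚᵘ using (+-cong; module ≤-Reasoning)
  open import Data.Sum using (_⊎_; inj₁; inj₂)
  open import Function using (_∘_; it)
  open import Relation.Binary.PropositionalEquality using (_≢_; refl; sym; trans; cong; cong₂; subst; subst₂; module ≡-Reasoning)
  open import Relation.Nullary using (does; yes; no; ¬_; contradiction)
  open +-*-Solver using (solve; con; _:+_; _:*_; _:=_)
  open import Algebra.Properties.CommutativeSemigroup +-commutativeSemigroup using (interchange)

  -- Sums over all words of a given length

  ∑ : ℕ → (Word → ℕ) → ℕ
  ∑ n f = sum (map f (wordsOfLength n))

  ∑-suc : ∀ n f → ∑ (suc n) f ≡ ∑ n (f ∘ (false ∷_)) + ∑ n (f ∘ (true ∷_))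
  ∑-suc n f = begin
    sum (map f (map (false ∷_) W ++ map (true ∷_) W))
      ≡⟨ cong sum (map-++ f (map (false ∷_) W) (map (true ∷_) W)) ⟩
    sum (map f (map (false ∷_) W) ++ map f (map (true ∷_) W))
      ≡⟨ sum-++ (map f (map (false ∷_) W)) _ ⟩
    sum (map f (map (false ∷_) W)) + sum (map f (map (true ∷_) W))
      ≡⟨ cong₂ (λ xs ys → sum xs + sum ys) (map-∘ W) (map-∘ W) ⟨
    ∑ n (f ∘ (false ∷_)) + ∑ n (f ∘ (true ∷_)) ∎
    where
    open ≡-Reasoning
    W = wordsOfLength n

  ∑-mono : ∀ n {f g} → (∀ w → length w ≡ n → f w ≤ g w) → ∑ n f ≤ ∑ n g
  ∑-mono zero h = +-monoˡ-≤ 0 (h [] refl)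
  ∑-mono (suc n) {f} {g} h rewrite ∑-suc n f | ∑-suc n g =
    +-mono-≤ (∑-mono n λ w e → h (false ∷ w) (cong suc e))
             (∑-mono n λ w e → h (true ∷ w) (cong suc e))

  ∑-length-cong : ∀ n {f g} → (∀ w → length w ≡ n → f w ≡ g w) → ∑ n f ≡ ∑ n g
  ∑-length-cong n h = ≤-antisym (∑-mono n λ w e → ≤-reflexive (h w e))
                                (∑-mono n λ w e → ≤-reflexive (sym (h w e)))

  ∑-cong : ∀ n {f g} → (∀ w → f w ≡ g w) → ∑ n f ≡ ∑ n g
  ∑-cong n h = ∑-length-cong n λ w _ → h w

  ∑-+ : ∀ n f g → ∑ n (λ w → f w + g w) ≡ ∑ n f + ∑ n g
  ∑-+ zero f g = solve 2 (λ x y → x :+ y :+ con 0 := (x :+ con 0) :+ (y :+ con 0)) refl (f []) (g [])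
  ∑-+ (suc n) f g
    rewrite ∑-suc n (λ w → f w + g w) | ∑-suc n f | ∑-suc n g
          | ∑-+ n (f ∘ (false ∷_)) (g ∘ (false ∷_)) | ∑-+ n (f ∘ (true ∷_)) (g ∘ (true ∷_)) =
    interchange (∑ n (f ∘ (false ∷_))) _ _ _

  ∑-* : ∀ n c f → ∑ n (λ w → c * f w) ≡ c * ∑ n f
  ∑-* zero c f = trans (+-identityʳ _) (cong (c *_) (sym (+-identityʳ (f []))))
  ∑-* (suc n) c f
    rewrite ∑-suc n (λ w → c * f w) | ∑-suc n f
          | ∑-* n c (f ∘ (false ∷_)) | ∑-* n c (f ∘ (true ∷_)) =
    sym (*-distribˡ-+ c _ _)

  ∑-const : ∀ n c → ∑ n (λ _ → c) ≡ 2 ^ n * c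
  ∑-const zero c = refl
  ∑-const (suc n) c rewrite ∑-suc n (λ _ → c) | ∑-const n c =
    solve 2 (λ p x → p :* x :+ p :* x := con 2 :* p :* x) refl (2 ^ n) c

  ∑-++ : ∀ a b f → ∑ (a + b) f ≡ ∑ a (λ u → ∑ b (λ v → f (u ++ v)))
  ∑-++ zero b f = sym (+-identityʳ _)
  ∑-++ (suc a) b f
    rewrite ∑-suc (a + b) f | ∑-suc a (λ u → ∑ b (λ v → f (u ++ v))) =
    cong₂ _+_ (∑-++ a b (f ∘ (false ∷_))) (∑-++ a b (f ∘ (true ∷_)))

  ∑-swap : ∀ a b (f : Word → Word → ℕ) →
    ∑ a (λ u → ∑ b (λ v → f u v)) ≡ ∑ b (λ v → ∑ a (λ u → f u v))
  ∑-swap zero b f = trans (+-identityʳ _) (∑-cong b λ v → sym (+-identityʳ (f [] v)))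
  ∑-swap (suc a) b f = begin
    ∑ (suc a) (λ u → ∑ b (f u))
      ≡⟨ ∑-suc a (λ u → ∑ b (f u)) ⟩
    ∑ a (λ u → ∑ b (f (false ∷ u))) + ∑ a (λ u → ∑ b (f (true ∷ u)))
      ≡⟨ cong₂ _+_ (∑-swap a b (f ∘ (false ∷_))) (∑-swap a b (f ∘ (true ∷_))) ⟩
    ∑ b (λ v → ∑ a (λ u → f (false ∷ u) v)) + ∑ b (λ v → ∑ a (λ u → f (true ∷ u) v))
      ≡⟨ ∑-+ b _ _ ⟨
    ∑ b (λ v → ∑ a (λ u → f (false ∷ u) v) + ∑ a (λ u → f (true ∷ u) v))
      ≡⟨ ∑-cong b (λ v → ∑-suc a (λ u → f u v)) ⟨
    ∑ b (λ v → ∑ (suc a) (λ u → f u v)) ∎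
    where open ≡-Reasoning

  -- Needed where words are taken apart at the right end: for the outer letters of a palindrome, for
  -- prefixes, and for the search, which fixes the last letter of the unread part first.
  ∑-suc-∷ʳ : ∀ n f → ∑ (suc n) f ≡ ∑ n (f ∘ (_∷ʳ false)) + ∑ n (f ∘ (_∷ʳ true))
  ∑-suc-∷ʳ zero f = ∑-suc zero f
  ∑-suc-∷ʳ (suc n) f
    rewrite ∑-suc (suc n) f
          | ∑-suc-∷ʳ n (f ∘ (false ∷_)) | ∑-suc-∷ʳ n (f ∘ (true ∷_))
          | ∑-suc n (f ∘ (_∷ʳ false)) | ∑-suc n (f ∘ (_∷ʳ true)) =
    interchange (∑ n (λ w → f (false ∷ w ∷ʳ false))) _ _ _

  -- Palindromic factorizations

  infixr 5 _∷_
  -- Indexing by word and number of factors allows induction on the first palindrome; the head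
  -- `x ∷ p` excludes empty factors. Apart from evaluating `m []`, later arguments reach `m` through
  -- `m-minimal` and `m-attained`.
  data PalFact : Word → ℕ → Set where
    []  : PalFact [] 0
    _∷_ : ∀ {x p t k} → IsPalindrome (x ∷ p) → PalFact t k → PalFact (x ∷ p ++ t) (suc k)

  letters : ∀ w → PalFact w (length w)
  letters [] = []
  letters (x ∷ w) = refl {x = [ x ]} ∷ letters w

  _++ᶠ_ : ∀ {u v j k} → PalFact u j → PalFact v k → PalFact (u ++ v) (j + k)
  [] ++ᶠ G = G
  _++ᶠ_ {v = v} (_∷_ {x} {p} {t} P F) G =
    subst (λ w → PalFact (x ∷ w) _) (sym (++-assoc p t v)) (P ∷ (F ++ᶠ G))

  factorizations-single : ∀ x w {f} → f ∈ factorizations w → ([ x ] ∷ f) ∈ factorizations (x ∷ w)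
  factorizations-single x w {[]} f∈ = ∈-concatMap⁺ _ (lose f∈ (here refl))
  factorizations-single x w {p ∷ f} f∈ = ∈-concatMap⁺ _ (lose f∈ (here refl))

  factorizations-extend : ∀ x w {p f} → (p ∷ f) ∈ factorizations w → ((x ∷ p) ∷ f) ∈ factorizations (x ∷ w)
  factorizations-extend x w f∈ = ∈-concatMap⁺ _ (lose f∈ (there (here refl)))

  -- A block is built from its last letter backwards: that letter opens a new factor, and every
  -- earlier one is absorbed by `factorizations-extend`.
  factorizations-prepend : ∀ x p t {f} → f ∈ factorizations t → ((x ∷ p) ∷ f) ∈ factorizations (x ∷ p ++ t)
  factorizations-prepend x [] t f∈ = factorizations-single x t f∈
  factorizations-prepend x (y ∷ p) t f∈ =
    factorizations-extend x (y ∷ p ++ t) (factorizations-prepend y p t f∈)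

  PalFact⇒factorization : ∀ {w k} → PalFact w k →
    ∃ λ f → f ∈ factorizations w × All IsPalindrome f × length f ≡ k
  PalFact⇒factorization [] = [] , here refl , [] , refl
  PalFact⇒factorization (_∷_ {x} {p} {t} P F) with f , f∈ , Ps , e ← PalFact⇒factorization F =
    (x ∷ p) ∷ f , factorizations-prepend x p t f∈ , P ∷ Ps , cong suc e

  data NonEmpty : Word → Set where
    nonEmpty : ∀ {x w} → NonEmpty (x ∷ w)

  -- Non-emptiness is tracked because `[]` satisfies `IsPalindrome`, while `PalFact` admits only
  -- nonempty factors.
  factorizations-sound : ∀ w {f} → f ∈ factorizations w → concat f ≡ w × All NonEmpty f
  factorizations-sound [] (here refl) = refl , []
  factorizations-sound (x ∷ w) f∈ with find (∈-concatMap⁻ _ {xs = factorizations w} f∈)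
  ... | [] , g∈ , here refl = cong (x ∷_) (proj₁ (factorizations-sound w g∈)) , nonEmpty ∷ []
  ... | p ∷ g , g∈ , here refl with e , ne ← factorizations-sound w g∈ = cong (x ∷_) e , nonEmpty ∷ ne
  ... | p ∷ g , g∈ , there (here refl) with e , _ ∷ ne ← factorizations-sound w g∈ = cong (x ∷_) e , nonEmpty ∷ ne

  ∈⇒PalFact : ∀ {w f} → f ∈ palFactorizations w → PalFact w (length f)
  ∈⇒PalFact {w} f∈ with f∈′ , Ps ← ∈-filter⁻ (all? isPalindrome?) {xs = factorizations w} f∈
                   with refl , ne ← factorizations-sound w f∈′ = go Ps ne
    where
    go : ∀ {f} → All IsPalindrome f → All NonEmpty f → PalFact (concat f) (length f)
    go [] [] = []
    go (P ∷ Ps) (nonEmpty ∷ ne) = P ∷ go Ps ne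

  m-minimal : ∀ {w k} → PalFact w k → m w ≤ k
  m-minimal {w} F with f , f∈ , Ps , refl ← PalFact⇒factorization F =
    go (∈-filter⁺ (all? isPalindrome?) f∈ Ps)
    where
    go : ∀ {f} {fs : List (List Word)} → f ∈ fs → foldr (λ f r → length f ⊓ r) (length w) fs ≤ length f
    go {f} (here refl) = m⊓n≤m (length f) _
    go {f} (there {x = g} f∈) = ≤-trans (m⊓n≤n (length g) _) (go f∈)

  m-attained : ∀ w → PalFact w (m w)
  m-attained w = go (palFactorizations w) ∈⇒PalFact
    where
    go : ∀ fs → (∀ {f} → f ∈ fs → PalFact w (length f)) →
      PalFact w (foldr (λ f r → length f ⊓ r) (length w) fs)
    -- The fold's default `length w` is attained by the factorization into letters.
    go [] _ = letters w
    go (f ∷ fs) h with ⊓-sel (length f) (foldr (λ f r → length f ⊓ r) (length w) fs)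
    ... | inj₁ e = subst (PalFact w) (sym e) (h (here refl))
    ... | inj₂ e = subst (PalFact w) (sym e) (go fs (h ∘ there))

  m≤length : ∀ w → m w ≤ length w
  m≤length w = m-minimal (letters w)

  m-++-≤ : ∀ u v → m (u ++ v) ≤ m u + m v
  m-++-≤ u v = m-minimal (m-attained u ++ᶠ m-attained v)

  m-prepend-≤ : ∀ p {t} → IsPalindrome p → m (p ++ t) ≤ suc (m t)
  m-prepend-≤ [] _ = n≤1+n _
  m-prepend-≤ (x ∷ p) {t} P = m-minimal (P ∷ m-attained t)

  m-prepend-length : ∀ p t → m (p ++ t) ≤ length p + m t
  m-prepend-length p t = m-minimal (letters p ++ᶠ m-attained t)

  -- Palindromes

  palindrome-wrap : ∀ x {q} → IsPalindrome q → IsPalindrome (x ∷ q ∷ʳ x)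
  palindrome-wrap x {q} P = sym (begin
    reverse (x ∷ q ∷ʳ x)     ≡⟨ unfold-reverse x (q ∷ʳ x) ⟩
    reverse (q ∷ʳ x) ∷ʳ x    ≡⟨ cong (_∷ʳ x) (reverse-++ q [ x ]) ⟩
    x ∷ reverse q ∷ʳ x       ≡⟨ cong (λ r → x ∷ r ∷ʳ x) P ⟨
    x ∷ q ∷ʳ x               ∎)
    where open ≡-Reasoning

  palindrome-unwrap : ∀ x q y → IsPalindrome (x ∷ q ∷ʳ y) → x ≡ y × IsPalindrome q
  palindrome-unwrap x q y P = ∷-injectiveˡ e , ∷ʳ-injectiveˡ q _ (∷-injectiveʳ e)
    where
    open ≡-Reasoning
    e : x ∷ q ∷ʳ y ≡ y ∷ reverse q ∷ʳ x
    e = begin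
      x ∷ q ∷ʳ y             ≡⟨ P ⟩
      reverse (x ∷ q ∷ʳ y)   ≡⟨ unfold-reverse x (q ∷ʳ y) ⟩
      reverse (q ∷ʳ y) ∷ʳ x  ≡⟨ cong (_∷ʳ x) (reverse-++ q [ y ]) ⟩
      y ∷ reverse q ∷ʳ x     ∎

  χ : Word → ℕ
  χ w = if does (isPalindrome? w) then 1 else 0

  χ-palindrome : ∀ {w} → IsPalindrome w → χ w ≡ 1
  χ-palindrome {w} P with isPalindrome? w
  ... | yes _ = refl
  ... | no ¬P = contradiction P ¬P

  χ-non-palindrome : ∀ {w} → ¬ IsPalindrome w → χ w ≡ 0
  χ-non-palindrome {w} ¬P with isPalindrome? w
  ... | yes P = contradiction P ¬P
  ... | no _ = refl

  χ-unwrap-≤ : ∀ x q → χ (x ∷ q ∷ʳ x) ≤ χ q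
  χ-unwrap-≤ x q with isPalindrome? (x ∷ q ∷ʳ x)
  ... | yes P = ≤-reflexive (sym (χ-palindrome (proj₂ (palindrome-unwrap x q x P))))
  ... | no _ = z≤n

  χ-unwrap-≢ : ∀ {x y} q → x ≢ y → χ (x ∷ q ∷ʳ y) ≡ 0
  χ-unwrap-≢ {x} {y} q x≢y = χ-non-palindrome (x≢y ∘ proj₁ ∘ palindrome-unwrap x q y)

  -- Removing the equal outer letters leaves a palindrome, so two more letters at most double the
  -- count.
  ∑χ≤ : ∀ l → ∑ l χ ≤ 2 ^ ⌈ l /2⌉
  ∑χ≤ zero = ≤-refl
  ∑χ≤ (suc zero) = ≤-refl
  ∑χ≤ (suc (suc l)) = begin
    ∑ (suc (suc l)) χ
      ≡⟨ ∑-suc (suc l) χ ⟩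
    ∑ (suc l) (χ ∘ (false ∷_)) + ∑ (suc l) (χ ∘ (true ∷_))
      ≡⟨ cong₂ _+_ (∑-suc-∷ʳ l (χ ∘ (false ∷_))) (∑-suc-∷ʳ l (χ ∘ (true ∷_))) ⟩
    (∑ l (λ q → χ (false ∷ q ∷ʳ false)) + ∑ l (λ q → χ (false ∷ q ∷ʳ true))) +
    (∑ l (λ q → χ (true ∷ q ∷ʳ false)) + ∑ l (λ q → χ (true ∷ q ∷ʳ true)))
      ≤⟨ +-mono-≤ (+-mono-≤ (same false) (≤-reflexive (differ λ ()))) (+-mono-≤ (≤-reflexive (differ λ ())) (same true)) ⟩
    (∑ l χ + 0) + (0 + ∑ l χ)
      ≡⟨ solve 1 (λ a → (a :+ con 0) :+ (con 0 :+ a) := con 2 :* a) refl (∑ l χ) ⟩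
    2 * ∑ l χ
      ≤⟨ *-monoʳ-≤ 2 (∑χ≤ l) ⟩
    2 * 2 ^ ⌈ l /2⌉ ∎
    where
    open ≤-Reasoning
    same : ∀ x → ∑ l (λ q → χ (x ∷ q ∷ʳ x)) ≤ ∑ l χ
    same x = ∑-mono l λ q _ → χ-unwrap-≤ x q
    differ : ∀ {x y} → x ≢ y → ∑ l (λ q → χ (x ∷ q ∷ʳ y)) ≡ 0
    differ x≢y = trans (∑-cong l λ q → χ-unwrap-≢ q x≢y) (trans (∑-const l 0) (*-zeroʳ (2 ^ l)))

  -- The density of palindromes, about 2^(-l/2), is bounded by 2·(3/4)^l, which is rational and
  -- splits into a product for `l = i + j`. Two steps multiply the left bound by 8 and the right by
  -- 9; the factor 2 serves the case `l = 1`.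
  2^l*∑χ≤2*3^l : ∀ l → 2 ^ l * ∑ l χ ≤ 2 * 3 ^ l
  2^l*∑χ≤2*3^l l = ≤-trans (*-monoʳ-≤ (2 ^ l) (∑χ≤ l)) (go l)
    where
    open ≤-Reasoning
    go : ∀ l → 2 ^ l * 2 ^ ⌈ l /2⌉ ≤ 2 * 3 ^ l
    go zero = s≤s z≤n
    go (suc zero) = m≤m+n 4 2
    go (suc (suc l)) = begin
      2 * (2 * 2 ^ l) * (2 * 2 ^ ⌈ l /2⌉)
        ≡⟨ solve 2 (λ a b → con 2 :* (con 2 :* a) :* (con 2 :* b) := con 8 :* (a :* b)) refl (2 ^ l) (2 ^ ⌈ l /2⌉) ⟩
      8 * (2 ^ l * 2 ^ ⌈ l /2⌉)
        ≤⟨ *-mono-≤ (n≤1+n 8) (go l) ⟩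
      9 * (2 * 3 ^ l)
        ≡⟨ solve 1 (λ a → con 9 :* (con 2 :* a) := con 2 :* (con 3 :* (con 3 :* a))) refl (3 ^ l) ⟩
      2 * (3 * (3 * 3 ^ l)) ∎

  -- Almost additivity of m on average

  ∑prefix : (Word → ℕ) → Word → ℕ
  ∑prefix G [] = G []
  ∑prefix G (x ∷ v) = G [] + ∑prefix (G ∘ (x ∷_)) v

  ∑suffix : (Word → ℕ) → Word → ℕ
  ∑suffix G [] = G []
  ∑suffix G (x ∷ u) = G (x ∷ u) + ∑suffix G u

  ∑prefix-∷ʳ : ∀ G v x → ∑prefix G (v ∷ʳ x) ≡ G (v ∷ʳ x) + ∑prefix G v
  ∑prefix-∷ʳ G [] x = +-comm (G []) _
  ∑prefix-∷ʳ G (y ∷ v) x rewrite ∑prefix-∷ʳ (G ∘ (y ∷_)) v x =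
    solve 3 (λ a b c → a :+ (b :+ c) := b :+ (a :+ c)) refl (G []) (G (y ∷ v ∷ʳ x)) _

  ∑prefix-∑ : ∀ n (H : Word → Word → ℕ) v → ∑prefix (λ r → ∑ n (λ s → H s r)) v ≡ ∑ n (λ s → ∑prefix (H s) v)
  ∑prefix-∑ n H [] = refl
  ∑prefix-∑ n H (x ∷ v) =
    trans (cong (∑ n (λ s → H s []) +_) (∑prefix-∑ n (λ s r → H s (x ∷ r)) v)) (sym (∑-+ n _ _))

  ∑suffix-∑ : ∀ n (H : Word → Word → ℕ) u → ∑suffix (λ s → ∑ n (λ v → H v s)) u ≡ ∑ n (λ v → ∑suffix (H v) u)
  ∑suffix-∑ n H [] = refl
  ∑suffix-∑ n H (x ∷ u) =
    trans (cong (∑ n (λ v → H v (x ∷ u)) +_) (∑suffix-∑ n H u)) (sym (∑-+ n _ _))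

  -- The proper suffixes of `x ∷ u` are the suffixes of `u`, met once for each of the two letters
  -- `x`.
  ∑-∑suffix-suc : ∀ n G → ∑ (suc n) (∑suffix G) ≡ ∑ (suc n) G + 2 * ∑ n (∑suffix G)
  ∑-∑suffix-suc n G
    rewrite ∑-suc n (∑suffix G) | ∑-suc n G
          | ∑-+ n (G ∘ (false ∷_)) (∑suffix G) | ∑-+ n (G ∘ (true ∷_)) (∑suffix G) =
    solve 3 (λ a b c → (a :+ c) :+ (b :+ c) := (a :+ b) :+ con 2 :* c) refl (∑ n (G ∘ (false ∷_))) (∑ n (G ∘ (true ∷_))) (∑ n (∑suffix G))

  ∑-∑prefix-suc : ∀ n G → ∑ (suc n) (∑prefix G) ≡ ∑ (suc n) G + 2 * ∑ n (∑prefix G)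
  ∑-∑prefix-suc n G
    rewrite ∑-suc-∷ʳ n (∑prefix G) | ∑-suc-∷ʳ n G
          | ∑-cong n (λ v → ∑prefix-∷ʳ G v false) | ∑-cong n (λ v → ∑prefix-∷ʳ G v true)
          | ∑-+ n (G ∘ (_∷ʳ false)) (∑prefix G) | ∑-+ n (G ∘ (_∷ʳ true)) (∑prefix G) =
    solve 3 (λ a b c → (a :+ c) :+ (b :+ c) := (a :+ b) :+ con 2 :* c) refl (∑ n (G ∘ (_∷ʳ false))) (∑ n (G ∘ (_∷ʳ true))) (∑ n (∑prefix G))

  -- A given word is a prefix of as many words of length `n` as it is a suffix of; formally, both
  -- sums obey one recurrence. Hence `∑-∑suffix-≤` serves both sides of a cut.
  ∑-∑prefix≡∑-∑suffix : ∀ n G → ∑ n (∑prefix G) ≡ ∑ n (∑suffix G)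
  ∑-∑prefix≡∑-∑suffix zero G = refl
  ∑-∑prefix≡∑-∑suffix (suc n) G
    rewrite ∑-∑prefix-suc n G | ∑-∑suffix-suc n G | ∑-∑prefix≡∑-∑suffix n G = refl

  -- The closed form 12·4ⁿ − (3n + 12)·3ⁿ of Σᵢ i·3ⁱ·4ⁿ⁻ⁱ drives the induction.
  ∑-∑suffix-≤ : ∀ G B → (∀ i → 2 ^ i * ∑ i G ≤ B * (i * 3 ^ i)) → ∀ n → ∑ n (∑suffix G) ≤ 12 * B * 2 ^ n
  ∑-∑suffix-≤ G B h n = *-cancelˡ-≤ (2 ^ n) {{m^n≢0 2 n}} (begin
    2 ^ n * ∑ n (∑suffix G)                                     ≤⟨ m≤m+n _ _ ⟩
    2 ^ n * ∑ n (∑suffix G) + B * ((3 * n + 12) * 3 ^ n)        ≤⟨ go n ⟩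
    12 * B * (2 ^ n * 2 ^ n)
      ≡⟨ solve 2 (λ b p → con 12 :* b :* (p :* p) := p :* (con 12 :* b :* p)) refl B (2 ^ n) ⟩
    2 ^ n * (12 * B * 2 ^ n)                                    ∎)
    where
    open ≤-Reasoning
    go : ∀ n → 2 ^ n * ∑ n (∑suffix G) + B * ((3 * n + 12) * 3 ^ n) ≤ 12 * B * (2 ^ n * 2 ^ n)
    go zero = begin
      1 * (G [] + 0) + B * 12    ≤⟨ +-monoˡ-≤ (B * 12) (h 0) ⟩
      B * 0 + B * 12             ≡⟨ solve 1 (λ b → b :* con 0 :+ b :* con 12 := con 12 :* b :* con 1) refl B ⟩
      12 * B * 1                 ∎
    go (suc n) = begin
      2 ^ suc n * ∑ (suc n) (∑suffix G) + B * ((3 * suc n + 12) * 3 ^ suc n)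
        ≡⟨ cong (λ z → 2 ^ suc n * z + B * ((3 * suc n + 12) * 3 ^ suc n)) (∑-∑suffix-suc n G) ⟩
      2 * p * (g + 2 * S) + B * ((3 * suc n + 12) * (3 * q))
        ≡⟨ solve 6 (λ p g S B n q →
             con 2 :* p :* (g :+ con 2 :* S) :+ B :* ((con 3 :* (con 1 :+ n) :+ con 12) :* (con 3 :* q)) :=
             con 2 :* p :* g :+ (con 4 :* (p :* S) :+ B :* ((con 3 :* (con 1 :+ n) :+ con 12) :* (con 3 :* q))))
             refl p g S B n q ⟩
      2 * p * g + (4 * (p * S) + B * ((3 * suc n + 12) * (3 * q)))
        ≤⟨ +-monoˡ-≤ _ (h (suc n)) ⟩
      B * (suc n * (3 * q)) + (4 * (p * S) + B * ((3 * suc n + 12) * (3 * q)))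
        ≡⟨ solve 5 (λ p S B n q →
             B :* ((con 1 :+ n) :* (con 3 :* q)) :+ (con 4 :* (p :* S) :+ B :* ((con 3 :* (con 1 :+ n) :+ con 12) :* (con 3 :* q))) :=
             con 4 :* (p :* S :+ B :* ((con 3 :* n :+ con 12) :* q)))
             refl p S B n q ⟩
      4 * (p * S + B * ((3 * n + 12) * q))
        ≤⟨ *-monoʳ-≤ 4 (go n) ⟩
      4 * (12 * B * (p * p))
        ≡⟨ solve 2 (λ p B → con 4 :* (con 12 :* B :* (p :* p)) := con 12 :* B :* (con 2 :* p :* (con 2 :* p))) refl p B ⟩
      12 * B * (2 ^ suc n * 2 ^ suc n) ∎
      where
      p = 2 ^ n
      q = 3 ^ n
      g = ∑ (suc n) G
      S = ∑ n (∑suffix G)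

  ∑prefix-≥ : ∀ G r {t} → G r ≤ ∑prefix G (r ++ t)
  ∑prefix-≥ G [] {[]} = ≤-refl
  ∑prefix-≥ G [] {x ∷ t} = m≤m+n _ _
  ∑prefix-≥ G (x ∷ r) = ≤-trans (∑prefix-≥ (G ∘ (x ∷_)) r) (m≤n+m _ _)

  ∑suffix-≥ : ∀ G u → G u ≤ ∑suffix G u
  ∑suffix-≥ G [] = ≤-refl
  ∑suffix-≥ G (x ∷ u) = m≤m+n _ _

  ∑suffix-++ : ∀ G p {u} → ∑suffix G u ≤ ∑suffix G (p ++ u)
  ∑suffix-++ G [] = ≤-refl
  ∑suffix-++ G (x ∷ p) = ≤-trans (∑suffix-++ G p) (m≤n+m _ _)

  -- The weight |s|·|r| dominates |s| + |r| − 1, the cost of splitting a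
  -- palindrome s ++ r across the cut into letters.
  crossing : Word → Word → ℕ
  crossing s r = length s * length r * χ (s ++ r)

  crossings : Word → Word → ℕ
  crossings u v = ∑suffix (λ s → ∑prefix (crossing s) v) u

  -- Levi's lemma. In the first case the cut between `u` and `v` lies not before the end of `p`, in
  -- the second not after it.
  ++-split : ∀ {p t u v : Word} → p ++ t ≡ u ++ v →
    (∃ λ u′ → u ≡ p ++ u′ × t ≡ u′ ++ v) ⊎
    (∃ λ r → p ≡ u ++ r × v ≡ r ++ t)
  ++-split {[]} {u = u} e = inj₁ (u , refl , e)
  ++-split {x ∷ p} {u = []} e = inj₂ (x ∷ p , refl , sym e)
  ++-split {x ∷ p} {u = y ∷ u} e with refl ← ∷-injectiveˡ e with ++-split {p} {u = u} (∷-injectiveʳ e)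
  ... | inj₁ (u′ , refl , e′) = inj₁ (u′ , refl , e′)
  ... | inj₂ (r , refl , e′) = inj₂ (r , refl , e′)

  +≤1+* : ∀ a b → suc a + suc b ≤ 1 + suc a * suc b
  +≤1+* a b = ≤-trans (m≤m+n _ (a * b)) (≤-reflexive
    (solve 2 (λ a b → ((con 1 :+ a) :+ (con 1 :+ b)) :+ a :* b := con 1 :+ (con 1 :+ a) :* (con 1 :+ b)) refl a b))

  -- Induction along the factorization: palindromes that end before the cut stay with `u`, one
  -- across it is broken into letters, and the others stay with `v`.
  m-cut : ∀ u v {w k} → PalFact w k → w ≡ u ++ v → m u + m v ≤ k + crossings u v
  m-cut [] [] [] e = z≤n
  m-cut u v (_∷_ {x} {p} {t} {k} P F) e with ++-split {x ∷ p} {u = u} e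
  ... | inj₁ (u′ , refl , e′) = begin
    m ((x ∷ p) ++ u′) + m v                  ≤⟨ +-monoˡ-≤ (m v) (m-prepend-≤ (x ∷ p) P) ⟩
    suc (m u′ + m v)                         ≤⟨ s≤s (m-cut u′ v F e′) ⟩
    suc (k + crossings u′ v)                 ≤⟨ +-monoʳ-≤ (suc k) (∑suffix-++ _ (x ∷ p)) ⟩
    suc k + crossings ((x ∷ p) ++ u′) v      ∎
    where open ≤-Reasoning
  -- Nothing of `u` is left, so all remaining palindromes belong to `v`; `m []` computes to 0.
  m-cut [] v (P ∷ F) e | inj₂ (r , refl , refl) =
    ≤-trans (m-minimal (P ∷ F)) (m≤m+n _ _)
  -- With an empty `r` the cut falls at the end of the first palindrome, and none is broken.
  m-cut (y ∷ u) v (_∷_ {t = t} {k} P F) e | inj₂ ([] , e₁ , refl) = begin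
    m (y ∷ u) + m t    ≤⟨ +-mono-≤ (m-minimal {k = 1} (subst (λ w → PalFact w 1) (trans (++-identityʳ _) (trans e₁ (++-identityʳ _))) (P ∷ []))) (m-minimal F) ⟩
    suc k              ≤⟨ m≤m+n (suc k) _ ⟩
    suc k + crossings (y ∷ u) t ∎
    where open ≤-Reasoning
  m-cut (y ∷ u) v (_∷_ {t = t} {k} P F) e | inj₂ (z ∷ r , refl , refl) = begin
    m (y ∷ u) + m (z ∷ r ++ t)
      ≤⟨ +-mono-≤ (m≤length (y ∷ u)) (≤-trans (m-prepend-length (z ∷ r) t) (+-monoʳ-≤ (suc (length r)) (m-minimal F))) ⟩
    suc (length u) + (suc (length r) + k)
      ≡⟨ +-assoc (suc (length u)) (suc (length r)) k ⟨
    suc (length u) + suc (length r) + k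
      -- The broken palindrome itself pays for one of its letters, `L` for the others.
      ≤⟨ +-monoˡ-≤ k (+≤1+* (length u) (length r)) ⟩
    1 + L + k
      ≡⟨ solve 2 (λ L k → con 1 :+ L :+ k := con 1 :+ k :+ L :* con 1) refl L k ⟩
    suc k + L * 1
      ≡⟨ cong (λ c → suc k + L * c) (χ-palindrome P) ⟨
    suc k + crossing (y ∷ u) (z ∷ r)
      ≤⟨ +-monoʳ-≤ (suc k) (≤-trans (∑prefix-≥ (crossing (y ∷ u)) (z ∷ r)) (∑suffix-≥ _ (y ∷ u))) ⟩
    suc k + crossings (y ∷ u) (z ∷ r ++ t) ∎
    where
    open ≤-Reasoning
    L = suc (length u) * suc (length r)

  ∑∑crossing : ∀ i j → ∑ j (λ r → ∑ i (λ s → crossing s r)) ≡ i * j * ∑ (i + j) χ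
  ∑∑crossing i j = begin
    ∑ j (λ r → ∑ i (λ s → crossing s r))
      ≡⟨ ∑-swap i j crossing ⟨
    ∑ i (λ s → ∑ j (λ r → crossing s r))
      ≡⟨ ∑-length-cong i (λ s es → ∑-length-cong j (λ r er → cong₂ (λ a b → a * b * χ (s ++ r)) es er)) ⟩
    ∑ i (λ s → ∑ j (λ r → i * j * χ (s ++ r)))
      ≡⟨ ∑-cong i (λ s → ∑-* j (i * j) (λ r → χ (s ++ r))) ⟩
    ∑ i (λ s → i * j * ∑ j (λ r → χ (s ++ r)))
      ≡⟨ ∑-* i (i * j) _ ⟩
    i * j * ∑ i (λ s → ∑ j (λ r → χ (s ++ r)))
      ≡⟨ cong (i * j *_) (∑-++ i j χ) ⟨
    i * j * ∑ (i + j) χ ∎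
    where open ≡-Reasoning

  -- Summing over `s` first leaves a function of `r` alone, so `∑-∑suffix-≤` applies to the words
  -- `v` with `i` fixed. The result has the form `B * (i * 3 ^ i)` required to apply it again to the
  -- words `u`.
  2^i*∑∑crossing-≤ : ∀ i b → 2 ^ i * ∑ i (λ s → ∑ b (λ v → ∑prefix (crossing s) v)) ≤ 24 * 2 ^ b * (i * 3 ^ i)
  2^i*∑∑crossing-≤ i b = begin
    2 ^ i * ∑ i (λ s → ∑ b (λ v → ∑prefix (crossing s) v))
      ≡⟨ cong (2 ^ i *_) (∑-swap i b _) ⟩
    2 ^ i * ∑ b (λ v → ∑ i (λ s → ∑prefix (crossing s) v))
      ≡⟨ cong (2 ^ i *_) (∑-cong b (∑prefix-∑ i crossing)) ⟨
    2 ^ i * ∑ b (∑prefix G)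
      ≡⟨ cong (2 ^ i *_) (∑-∑prefix≡∑-∑suffix b G) ⟩
    2 ^ i * ∑ b (∑suffix G)
      ≡⟨ ∑-* b (2 ^ i) (∑suffix G) ⟨
    ∑ b (λ v → 2 ^ i * ∑suffix G v)
      ≡⟨ ∑-cong b scale ⟩
    ∑ b (∑suffix (λ r → 2 ^ i * G r))
      ≤⟨ ∑-∑suffix-≤ _ (2 * (i * 3 ^ i)) bound b ⟩
    12 * (2 * (i * 3 ^ i)) * 2 ^ b
      ≡⟨ solve 2 (λ a p → con 12 :* (con 2 :* a) :* p := con 24 :* p :* a) refl (i * 3 ^ i) (2 ^ b) ⟩
    24 * 2 ^ b * (i * 3 ^ i) ∎
    where
    open ≤-Reasoning
    G : Word → ℕ
    G r = ∑ i (λ s → crossing s r)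
    scale : ∀ v → 2 ^ i * ∑suffix G v ≡ ∑suffix (λ r → 2 ^ i * G r) v
    scale [] = refl
    scale (x ∷ v) = trans (*-distribˡ-+ (2 ^ i) (G (x ∷ v)) _) (cong (2 ^ i * G (x ∷ v) +_) (scale v))
    bound : ∀ j → 2 ^ j * ∑ j (λ r → 2 ^ i * G r) ≤ 2 * (i * 3 ^ i) * (j * 3 ^ j)
    bound j = begin
      2 ^ j * ∑ j (λ r → 2 ^ i * G r)
        ≡⟨ cong (2 ^ j *_) (trans (∑-* j (2 ^ i) G) (cong (2 ^ i *_) (∑∑crossing i j))) ⟩
      2 ^ j * (2 ^ i * (i * j * ∑ (i + j) χ))
        ≡⟨ solve 5 (λ p q i j c → q :* (p :* (i :* j :* c)) := i :* j :* (p :* q :* c)) refl (2 ^ i) (2 ^ j) i j (∑ (i + j) χ) ⟩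
      i * j * (2 ^ i * 2 ^ j * ∑ (i + j) χ)
        ≡⟨ cong (λ z → i * j * (z * ∑ (i + j) χ)) (^-distribˡ-+-* 2 i j) ⟨
      i * j * (2 ^ (i + j) * ∑ (i + j) χ)
        ≤⟨ *-monoʳ-≤ (i * j) (2^l*∑χ≤2*3^l (i + j)) ⟩
      i * j * (2 * 3 ^ (i + j))
        ≡⟨ cong (λ z → i * j * (2 * z)) (^-distribˡ-+-* 3 i j) ⟩
      i * j * (2 * (3 ^ i * 3 ^ j))
        ≡⟨ solve 4 (λ p q i j → i :* j :* (con 2 :* (p :* q)) := con 2 :* (i :* p) :* (j :* q)) refl (3 ^ i) (3 ^ j) i j ⟩
      2 * (i * 3 ^ i) * (j * 3 ^ j) ∎

  -- The constant is 12 · 12 · 2: a factor 12 for each side of the cut, and 2 from the density bound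
  -- for palindromes.
  ∑∑crossings-≤ : ∀ a b → ∑ a (λ u → ∑ b (λ v → crossings u v)) ≤ 288 * (2 ^ a * 2 ^ b)
  ∑∑crossings-≤ a b = begin
    ∑ a (λ u → ∑ b (λ v → crossings u v))
      ≡⟨ ∑-cong a (∑suffix-∑ b (λ v s → ∑prefix (crossing s) v)) ⟨
    ∑ a (∑suffix (λ s → ∑ b (λ v → ∑prefix (crossing s) v)))
      ≤⟨ ∑-∑suffix-≤ _ (24 * 2 ^ b) (λ i → 2^i*∑∑crossing-≤ i b) a ⟩
    12 * (24 * 2 ^ b) * 2 ^ a
      ≡⟨ solve 2 (λ p q → con 12 :* (con 24 :* q) :* p := con 288 :* (p :* q)) refl (2 ^ a) (2 ^ b) ⟩
    288 * (2 ^ a * 2 ^ b) ∎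
    where open ≤-Reasoning

  ∑∑-+ : ∀ a b f g → ∑ a (λ u → ∑ b (λ v → f u + g v)) ≡ 2 ^ b * ∑ a f + 2 ^ a * ∑ b g
  ∑∑-+ a b f g = begin
    ∑ a (λ u → ∑ b (λ v → f u + g v))
      ≡⟨ ∑-cong a (λ u → trans (∑-+ b _ g) (cong (_+ ∑ b g) (∑-const b (f u)))) ⟩
    ∑ a (λ u → 2 ^ b * f u + ∑ b g)
      ≡⟨ ∑-+ a _ _ ⟩
    ∑ a (λ u → 2 ^ b * f u) + ∑ a (λ _ → ∑ b g)
      ≡⟨ cong₂ _+_ (∑-* a (2 ^ b) f) (∑-const a (∑ b g)) ⟩
    2 ^ b * ∑ a f + 2 ^ a * ∑ b g ∎
    where open ≡-Reasoning

  -- Sub- and superadditivity of `sumM`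

  sumM-subadditive : ∀ a b → sumM (a + b) ≤ 2 ^ b * sumM a + 2 ^ a * sumM b
  sumM-subadditive a b = begin
    ∑ (a + b) m                        ≡⟨ ∑-++ a b m ⟩
    ∑ a (λ u → ∑ b (λ v → m (u ++ v))) ≤⟨ ∑-mono a (λ u _ → ∑-mono b (λ v _ → m-++-≤ u v)) ⟩
    ∑ a (λ u → ∑ b (λ v → m u + m v))  ≡⟨ ∑∑-+ a b m m ⟩
    2 ^ b * sumM a + 2 ^ a * sumM b    ∎
    where open ≤-Reasoning

  sumM-almost-superadditive : ∀ a b →
    2 ^ b * sumM a + 2 ^ a * sumM b ≤ sumM (a + b) + 288 * (2 ^ a * 2 ^ b)
  sumM-almost-superadditive a b = begin
    2 ^ b * sumM a + 2 ^ a * sumM b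
      ≡⟨ ∑∑-+ a b m m ⟨
    ∑ a (λ u → ∑ b (λ v → m u + m v))
      ≤⟨ ∑-mono a (λ u _ → ∑-mono b (λ v _ → m-cut u v (m-attained (u ++ v)) refl)) ⟩
    ∑ a (λ u → ∑ b (λ v → m (u ++ v) + crossings u v))
      ≡⟨ trans (∑-cong a (λ u → ∑-+ b _ _)) (∑-+ a _ _) ⟩
    ∑ a (λ u → ∑ b (λ v → m (u ++ v))) + ∑ a (λ u → ∑ b (λ v → crossings u v))
      ≤⟨ +-mono-≤ (≤-reflexive (sym (∑-++ a b m))) (∑∑crossings-≤ a b) ⟩
    sumM (a + b) + 288 * (2 ^ a * 2 ^ b) ∎
    where open ≤-Reasoning

  -- Iterated subadditivity: divided by `2 ^ n * 2 ^ (k * n)`, this reads K̄(kn) ≤ k·K̄(n).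
  sumM-multiple-≤ : ∀ k n → 2 ^ n * sumM (k * n) ≤ k * (2 ^ (k * n) * sumM n)
  sumM-multiple-≤ zero n = ≤-reflexive (*-zeroʳ (2 ^ n))
  sumM-multiple-≤ (suc k) n = begin
    2 ^ n * sumM (n + k * n)
      ≤⟨ *-monoʳ-≤ (2 ^ n) (sumM-subadditive n (k * n)) ⟩
    p * (q * sumM n + p * sumM (k * n))
      ≤⟨ *-monoʳ-≤ p (+-monoʳ-≤ (q * sumM n) (sumM-multiple-≤ k n)) ⟩
    p * (q * sumM n + k * (q * sumM n))
      ≡⟨ solve 4 (λ p q s k → p :* (q :* s :+ k :* (q :* s)) := (con 1 :+ k) :* (p :* q :* s)) refl p q (sumM n) k ⟩
    suc k * (p * q * sumM n)
      ≡⟨ cong (λ z → suc k * (z * sumM n)) (^-distribˡ-+-* 2 n (k * n)) ⟨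
    suc k * (2 ^ (n + k * n) * sumM n) ∎
    where
    open ≤-Reasoning
    p = 2 ^ n
    q = 2 ^ (k * n)

  -- Blocks are joined one at a time, each at an average cost of at most 288: k·K̄(n) ≤ K̄(kn) +
  -- 288k.
  sumM-multiple-≥ : ∀ k n →
    k * (2 ^ (k * n) * sumM n) ≤ 2 ^ n * (sumM (k * n) + k * (288 * 2 ^ (k * n)))
  sumM-multiple-≥ zero n = z≤n
  sumM-multiple-≥ (suc k) n = begin
    suc k * (2 ^ (n + k * n) * sumM n)
      ≡⟨ cong (λ z → suc k * (z * sumM n)) (^-distribˡ-+-* 2 n (k * n)) ⟩
    suc k * (p * q * sumM n)
      ≡⟨ solve 4 (λ p q s k → (con 1 :+ k) :* (p :* q :* s) := p :* (q :* s :+ k :* (q :* s))) refl p q (sumM n) k ⟩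
    p * (q * sumM n + k * (q * sumM n))
      ≤⟨ *-monoʳ-≤ p (+-monoʳ-≤ (q * sumM n) (sumM-multiple-≥ k n)) ⟩
    p * (q * sumM n + p * (sumM (k * n) + k * (288 * q)))
      ≡⟨ solve 5 (λ p q s k t → p :* (q :* s :+ p :* (t :+ k :* (con 288 :* q))) := p :* (q :* s :+ p :* t :+ k :* (con 288 :* (p :* q)))) refl p q (sumM n) k (sumM (k * n)) ⟩
    p * (q * sumM n + p * sumM (k * n) + k * (288 * (p * q)))
      ≤⟨ *-monoʳ-≤ p (+-monoˡ-≤ _ (sumM-almost-superadditive n (k * n))) ⟩
    p * (sumM (n + k * n) + 288 * (p * q) + k * (288 * (p * q)))
      ≡⟨ cong (p *_) (+-assoc (sumM (n + k * n)) _ _) ⟩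
    p * (sumM (n + k * n) + suc k * (288 * (p * q)))
      ≡⟨ cong (λ z → p * (sumM (n + k * n) + suc k * (288 * z))) (^-distribˡ-+-* 2 n (k * n)) ⟨
    p * (sumM (n + k * n) + suc k * (288 * 2 ^ (n + k * n))) ∎
    where
    open ≤-Reasoning
    p = 2 ^ n
    q = 2 ^ (k * n)

  -- K̄(n)/n ≤ K̄(k)/k + 288/n with denominators cleared: compare both with K̄(kn)/(kn).
  sumM-compare : ∀ n k →
    k * 2 ^ k * sumM n ≤ 2 ^ n * (n * sumM k + 288 * (k * 2 ^ k))
  sumM-compare n k = *-cancelˡ-≤ Q {{m^n≢0 2 (k * n)}} (begin
    Q * (k * K * sumM n)
      ≡⟨ solve 4 (λ Q k K s → Q :* (k :* K :* s) := K :* (k :* (Q :* s))) refl Q k K (sumM n) ⟩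
    K * (k * (Q * sumM n))
      ≤⟨ *-monoʳ-≤ K (sumM-multiple-≥ k n) ⟩
    K * (N * (sumM (k * n) + k * (288 * Q)))
      ≡⟨ solve 5 (λ K N s k Q → K :* (N :* (s :+ k :* (con 288 :* Q))) := N :* (K :* s :+ Q :* (con 288 :* (k :* K)))) refl K N (sumM (k * n)) k Q ⟩
    N * (K * sumM (k * n) + Q * (288 * (k * K)))
      ≤⟨ *-monoʳ-≤ N (+-monoˡ-≤ _ nk) ⟩
    N * (n * (Q * sumM k) + Q * (288 * (k * K)))
      ≡⟨ solve 5 (λ N n Q s c → N :* (n :* (Q :* s) :+ Q :* c) := Q :* (N :* (n :* s :+ c))) refl N n Q (sumM k) (288 * (k * K)) ⟩
    Q * (N * (n * sumM k + 288 * (k * K))) ∎)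
    where
    open ≤-Reasoning
    N = 2 ^ n
    K = 2 ^ k
    Q = 2 ^ (k * n)
    nk : K * sumM (k * n) ≤ n * (Q * sumM k)
    nk = subst (λ z → K * sumM z ≤ n * (2 ^ z * sumM k)) (*-comm n k) (sumM-multiple-≤ n k)

  -- A lower bound by an exponential moment

  conv : ℕ → (ℕ → ℕ → ℕ) → ℕ
  conv zero h = h 0 0
  conv (suc n) h = h 0 (suc n) + conv n (h ∘ suc)

  conv-mono : ∀ n {h h′} → (∀ i j → i + j ≡ n → h i j ≤ h′ i j) → conv n h ≤ conv n h′
  conv-mono zero le = le 0 0 refl
  conv-mono (suc n) le = +-mono-≤ (le 0 (suc n) refl) (conv-mono n λ i j e → le (suc i) j (cong suc e))

  conv-+ : ∀ n h h′ → conv n (λ i j → h i j + h′ i j) ≡ conv n h + conv n h′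
  conv-+ zero h h′ = refl
  conv-+ (suc n) h h′ rewrite conv-+ n (h ∘ suc) (h′ ∘ suc) = interchange (h 0 (suc n)) _ _ _

  conv-* : ∀ n c h → conv n (λ i j → c * h i j) ≡ c * conv n h
  conv-* zero c h = refl
  conv-* (suc n) c h rewrite conv-* n c (h ∘ suc) = sym (*-distribˡ-+ c (h 0 (suc n)) _)

  ∑split : (Word → Word → ℕ) → Word → ℕ
  ∑split g [] = g [] []
  ∑split g (x ∷ w) = g [] (x ∷ w) + ∑split (g ∘ (x ∷_)) w

  ∑split-≥ : ∀ g p {t} → g p t ≤ ∑split g (p ++ t)
  ∑split-≥ g [] {[]} = ≤-refl
  ∑split-≥ g [] {x ∷ t} = m≤m+n _ _
  ∑split-≥ g (x ∷ p) = ≤-trans (∑split-≥ (g ∘ (x ∷_)) p) (m≤n+m _ _)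

  ∑-∑split : ∀ n g → ∑ n (∑split g) ≡ conv n (λ i j → ∑ i (λ p → ∑ j (λ t → g p t)))
  ∑-∑split zero g = sym (+-identityʳ _)
  ∑-∑split (suc n) g = begin
    ∑ (suc n) (∑split g)
      ≡⟨ ∑-suc n (∑split g) ⟩
    ∑ n (λ w → g [] (false ∷ w) + ∑split (g ∘ (false ∷_)) w) + ∑ n (λ w → g [] (true ∷ w) + ∑split (g ∘ (true ∷_)) w)
      ≡⟨ cong₂ _+_ (∑-+ n _ _) (∑-+ n _ _) ⟩
    (∑ n (g [] ∘ (false ∷_)) + ∑ n (∑split (g ∘ (false ∷_)))) + (∑ n (g [] ∘ (true ∷_)) + ∑ n (∑split (g ∘ (true ∷_))))
      ≡⟨ interchange (∑ n (g [] ∘ (false ∷_))) _ _ _ ⟩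
    (∑ n (g [] ∘ (false ∷_)) + ∑ n (g [] ∘ (true ∷_))) + (∑ n (∑split (g ∘ (false ∷_))) + ∑ n (∑split (g ∘ (true ∷_))))
      ≡⟨ cong₂ _+_ (trans (sym (∑-suc n (g []))) (sym (+-identityʳ _)))
                   (cong₂ _+_ (∑-∑split n (g ∘ (false ∷_))) (∑-∑split n (g ∘ (true ∷_)))) ⟩
    (∑ (suc n) (g []) + 0) + (conv n (λ i j → ∑ i (λ p → ∑ j (g (false ∷ p)))) + conv n (λ i j → ∑ i (λ p → ∑ j (g (true ∷ p)))))
      ≡⟨ cong (∑ (suc n) (g []) + 0 +_) (conv-+ n _ _) ⟨
    (∑ (suc n) (g []) + 0) + conv n (λ i j → ∑ i (λ p → ∑ j (g (false ∷ p))) + ∑ i (λ p → ∑ j (g (true ∷ p))))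
      ≡⟨ cong (∑ (suc n) (g []) + 0 +_) (≤-antisym
           (conv-mono n λ i j _ → ≤-reflexive (sym (∑-suc i _)))
           (conv-mono n λ i j _ → ≤-reflexive (∑-suc i _))) ⟩
    (∑ (suc n) (g []) + 0) + conv n (λ i j → ∑ (suc i) (λ p → ∑ j (g p))) ∎
    where open ≡-Reasoning

  -- This is 20^(-m(w)) scaled by `20 ^ length w` to stay integral; by `m≤length` the subtraction
  -- does not truncate. The bound (3/2)ⁿ for the unscaled sum becomes `30 ^ n`.
  weight : Word → ℕ
  weight w = 20 ^ (length w ∸ m w)

  -- The first palindrome `x ∷ p` of an optimal factorization yields a single term of the sum that
  -- already suffices; the factor 20 on the left accounts for this palindrome.
  weight-recurrence : ∀ x w →
    20 * weight (x ∷ w) ≤ ∑split (λ p t → 20 ^ suc (length p) * χ (x ∷ p) * weight t) w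
  weight-recurrence x w = go (m-attained (x ∷ w)) refl refl
    where
    open ≤-Reasoning
    go : ∀ {w′ k} → PalFact w′ k → w′ ≡ x ∷ w → k ≡ m (x ∷ w) →
      20 * weight (x ∷ w) ≤ ∑split (λ p t → 20 ^ suc (length p) * χ (x ∷ p) * weight t) w
    go (_∷_ {p = p} {t} {k} P F) refl e = begin
      20 * 20 ^ (suc (length (p ++ t)) ∸ m (x ∷ p ++ t))
        ≡⟨ cong (λ z → 20 * 20 ^ (suc (length (p ++ t)) ∸ z)) e ⟨
      20 * 20 ^ (length (p ++ t) ∸ k)
        ≤⟨ *-monoʳ-≤ 20 (^-monoʳ-≤ 20 (∸-monoʳ-≤ (length (p ++ t)) (m-minimal F))) ⟩
      20 * 20 ^ (length (p ++ t) ∸ m t)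
        ≡⟨ cong (λ z → 20 * 20 ^ z) (trans (cong (_∸ m t) (length-++ p)) (+-∸-assoc (length p) (m≤length t))) ⟩
      20 * 20 ^ (length p + (length t ∸ m t))
        ≡⟨ ^-distribˡ-+-* 20 (suc (length p)) (length t ∸ m t) ⟩
      20 ^ suc (length p) * weight t
        ≡⟨ cong (_* weight t) (*-identityʳ (20 ^ suc (length p))) ⟨
      20 ^ suc (length p) * 1 * weight t
        ≡⟨ cong (λ z → 20 ^ suc (length p) * z * weight t) (χ-palindrome P) ⟨
      20 ^ suc (length p) * χ (x ∷ p) * weight t
        ≤⟨ ∑split-≥ (λ p t → 20 ^ suc (length p) * χ (x ∷ p) * weight t) p ⟩
      ∑split (λ p t → 20 ^ suc (length p) * χ (x ∷ p) * weight t) (p ++ t) ∎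

  -- P(z) = Σ 2^⌈l/2⌉ zˡ = (2z + 2z²)/(1 − 2z²) equals 20 at z = 2/3; here z = 20/30.
  conv-palindromes-≤ : ∀ n → conv n (λ l t → 20 ^ suc l * 2 ^ ⌈ suc l /2⌉ * 30 ^ t) ≤ 20 * 30 ^ suc n
  conv-palindromes-≤ zero = m≤m+n 40 560
  conv-palindromes-≤ (suc zero) = m≤m+n 2000 16000
  conv-palindromes-≤ (suc (suc n)) = begin
    40 * 30 ^ suc (suc n) + (800 * 30 ^ suc n + conv n (λ l t → 20 ^ suc (suc (suc l)) * 2 ^ suc ⌈ suc l /2⌉ * 30 ^ t))
      ≤⟨ +-monoʳ-≤ (40 * 30 ^ suc (suc n)) (+-monoʳ-≤ (800 * 30 ^ suc n) (conv-mono n λ l t _ → ≤-reflexive (scale l t))) ⟩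
    40 * 30 ^ suc (suc n) + (800 * 30 ^ suc n + conv n (λ l t → 800 * (20 ^ suc l * 2 ^ ⌈ suc l /2⌉ * 30 ^ t)))
      ≡⟨ cong (λ z → 40 * 30 ^ suc (suc n) + (800 * 30 ^ suc n + z)) (conv-* n 800 _) ⟩
    40 * 30 ^ suc (suc n) + (800 * 30 ^ suc n + 800 * conv n (λ l t → 20 ^ suc l * 2 ^ ⌈ suc l /2⌉ * 30 ^ t))
      ≤⟨ +-monoʳ-≤ (40 * 30 ^ suc (suc n)) (+-monoʳ-≤ (800 * 30 ^ suc n) (*-monoʳ-≤ 800 (conv-palindromes-≤ n))) ⟩
    40 * 30 ^ suc (suc n) + (800 * 30 ^ suc n + 800 * (20 * 30 ^ suc n))
      ≡⟨ solve 1 (λ q → con 40 :* (con 30 :* q) :+ (con 800 :* q :+ con 800 :* (con 20 :* q)) := con 20 :* (con 30 :* (con 30 :* q))) refl (30 ^ suc n) ⟩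
    20 * 30 ^ suc (suc (suc n)) ∎
    where
    open ≤-Reasoning
    scale : ∀ l t → 20 ^ suc (suc (suc l)) * 2 ^ suc ⌈ suc l /2⌉ * 30 ^ t ≡ 800 * (20 ^ suc l * 2 ^ ⌈ suc l /2⌉ * 30 ^ t)
    scale l t = solve 3 (λ a b c → con 20 :* (con 20 :* a) :* (con 2 :* b) :* c := con 800 :* (a :* b :* c)) refl (20 ^ suc l) (2 ^ ⌈ suc l /2⌉) (30 ^ t)

  ∑weight≤ : ∀ n → ∑ n weight ≤ 30 ^ n
  ∑weight≤ n = go n n ≤-refl
    where
    open ≤-Reasoning
    -- Strong induction through the bound `b`, since what follows the first palindrome can have any
    -- length below `suc n`.
    go : ∀ b n → n ≤ b → ∑ n weight ≤ 30 ^ n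
    go b zero _ = ≤-refl
    go (suc b) (suc n) (s≤s n≤b) = *-cancelˡ-≤ 20 (begin
      20 * ∑ (suc n) weight
        ≡⟨ trans (cong (20 *_) (∑-suc n weight)) (*-distribˡ-+ 20 (∑ n (weight ∘ (false ∷_))) _) ⟩
      20 * ∑ n (weight ∘ (false ∷_)) + 20 * ∑ n (weight ∘ (true ∷_))
        ≤⟨ +-mono-≤ (bound false) (bound true) ⟩
      conv n (λ l t → 20 ^ suc l * ∑ l (χ ∘ (false ∷_)) * 30 ^ t) + conv n (λ l t → 20 ^ suc l * ∑ l (χ ∘ (true ∷_)) * 30 ^ t)
        ≡⟨ conv-+ n _ _ ⟨
      conv n (λ l t → 20 ^ suc l * ∑ l (χ ∘ (false ∷_)) * 30 ^ t + 20 ^ suc l * ∑ l (χ ∘ (true ∷_)) * 30 ^ t)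
        -- The two first letters together give all palindromes of length `suc l`, which `∑χ≤`
        -- counts.
        ≤⟨ conv-mono n (λ l t _ → collect l t) ⟩
      conv n (λ l t → 20 ^ suc l * 2 ^ ⌈ suc l /2⌉ * 30 ^ t)
        ≤⟨ conv-palindromes-≤ n ⟩
      20 * 30 ^ suc n ∎)
      where
      collect : ∀ l t → 20 ^ suc l * ∑ l (χ ∘ (false ∷_)) * 30 ^ t + 20 ^ suc l * ∑ l (χ ∘ (true ∷_)) * 30 ^ t
              ≤ 20 ^ suc l * 2 ^ ⌈ suc l /2⌉ * 30 ^ t
      collect l t = begin
        A * c₀ * B + A * c₁ * B    ≡⟨ solve 4 (λ A B x y → A :* x :* B :+ A :* y :* B := A :* (x :+ y) :* B) refl A B c₀ c₁ ⟩
        A * (c₀ + c₁) * B          ≡⟨ cong (λ z → A * z * B) (∑-suc l χ) ⟨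
        A * ∑ (suc l) χ * B        ≤⟨ *-monoˡ-≤ B (*-monoʳ-≤ A (∑χ≤ (suc l))) ⟩
        A * 2 ^ ⌈ suc l /2⌉ * B    ∎
        where
        A = 20 ^ suc l
        B = 30 ^ t
        c₀ = ∑ l (χ ∘ (false ∷_))
        c₁ = ∑ l (χ ∘ (true ∷_))
      bound : ∀ x → 20 * ∑ n (weight ∘ (x ∷_)) ≤ conv n (λ l t → 20 ^ suc l * ∑ l (χ ∘ (x ∷_)) * 30 ^ t)
      bound x = begin
        20 * ∑ n (weight ∘ (x ∷_))
          ≡⟨ ∑-* n 20 _ ⟨
        ∑ n (λ w → 20 * weight (x ∷ w))
          ≤⟨ ∑-mono n (λ w _ → weight-recurrence x w) ⟩
        ∑ n (∑split (λ p t → 20 ^ suc (length p) * χ (x ∷ p) * weight t))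
          ≡⟨ ∑-∑split n _ ⟩
        conv n (λ l t → ∑ l (λ p → ∑ t (λ v → 20 ^ suc (length p) * χ (x ∷ p) * weight v)))
          ≤⟨ conv-mono n piece ⟩
        conv n (λ l t → 20 ^ suc l * ∑ l (χ ∘ (x ∷_)) * 30 ^ t) ∎
        where
        piece : ∀ l t → l + t ≡ n →
          ∑ l (λ p → ∑ t (λ v → 20 ^ suc (length p) * χ (x ∷ p) * weight v)) ≤ 20 ^ suc l * ∑ l (χ ∘ (x ∷_)) * 30 ^ t
        piece l t e = begin
          ∑ l (λ p → ∑ t (λ v → 20 ^ suc (length p) * χ (x ∷ p) * weight v))
            ≡⟨ ∑-length-cong l (λ p ep → trans (∑-* t (20 ^ suc (length p) * χ (x ∷ p)) weight)
                 (trans (cong (λ z → 20 ^ suc z * χ (x ∷ p) * ∑ t weight) ep) (*-assoc (20 ^ suc l) (χ (x ∷ p)) _))) ⟩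
          ∑ l (λ p → 20 ^ suc l * (χ (x ∷ p) * ∑ t weight))
            ≡⟨ ∑-* l (20 ^ suc l) _ ⟩
          20 ^ suc l * ∑ l (λ p → χ (x ∷ p) * ∑ t weight)
            ≡⟨ cong (20 ^ suc l *_) (trans (∑-cong l λ p → *-comm (χ (x ∷ p)) _) (trans (∑-* l (∑ t weight) _) (*-comm (∑ t weight) _))) ⟩
          20 ^ suc l * (∑ l (χ ∘ (x ∷_)) * ∑ t weight)
            ≡⟨ *-assoc (20 ^ suc l) _ _ ⟨
          20 ^ suc l * ∑ l (χ ∘ (x ∷_)) * ∑ t weight
            ≤⟨ *-monoʳ-≤ (20 ^ suc l * ∑ l (χ ∘ (x ∷_))) (go b t (≤-trans (≤-trans (m≤n+m t l) (≤-reflexive e)) n≤b)) ⟩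
          20 ^ suc l * ∑ l (χ ∘ (x ∷_)) * 30 ^ t ∎

  bernoulli : ∀ d → 1 + 19 * d ≤ 20 ^ d
  bernoulli zero = ≤-refl
  bernoulli (suc d) = begin
    1 + 19 * suc d                  ≤⟨ m≤m+n _ (361 * d) ⟩
    1 + 19 * suc d + 361 * d        ≡⟨ solve 1 (λ d → con 1 :+ con 19 :* (con 1 :+ d) :+ con 361 :* d := con 20 :* (con 1 :+ con 19 :* d)) refl d ⟩
    20 * (1 + 19 * d)               ≤⟨ *-monoʳ-≤ 20 (bernoulli d) ⟩
    20 * 20 ^ d                     ∎
    where open ≤-Reasoning

  -- 20ᵗ⁻ᵏ ≥ 1 + 19(t − k) for t ≥ k and for t < k alike, multiplied by 20ˢ.
  weight-convex : ∀ s t k → k ≤ s + t → 20 ^ s * (1 + 19 * t) ≤ 20 ^ (s + t ∸ k) + 20 ^ s * (19 * k)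
  weight-convex s t k k≤ with ≤-total k t
  ... | inj₁ k≤t = begin
    20 ^ s * (1 + 19 * t)                            ≡⟨ cong (λ z → 20 ^ s * (1 + 19 * z)) (m∸n+n≡m k≤t) ⟨
    20 ^ s * (1 + 19 * (t ∸ k + k))                  ≡⟨ solve 3 (λ a d k → a :* (con 1 :+ con 19 :* (d :+ k)) := a :* (con 1 :+ con 19 :* d) :+ a :* (con 19 :* k)) refl (20 ^ s) (t ∸ k) k ⟩
    20 ^ s * (1 + 19 * (t ∸ k)) + 20 ^ s * (19 * k)  ≤⟨ +-monoˡ-≤ _ (*-monoʳ-≤ (20 ^ s) (bernoulli (t ∸ k))) ⟩
    20 ^ s * 20 ^ (t ∸ k) + 20 ^ s * (19 * k)        ≡⟨ cong (_+ 20 ^ s * (19 * k)) (^-distribˡ-+-* 20 s (t ∸ k)) ⟨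
    20 ^ (s + (t ∸ k)) + 20 ^ s * (19 * k)           ≡⟨ cong (λ z → 20 ^ z + 20 ^ s * (19 * k)) (+-∸-assoc s k≤t) ⟨
    20 ^ (s + t ∸ k) + 20 ^ s * (19 * k)             ∎
    where open ≤-Reasoning
  ... | inj₂ t≤k with m≤n⇒m<n∨m≡n t≤k
  ...   | inj₂ refl rewrite m+n∸n≡m s t = ≤-reflexive (solve 2 (λ a t → a :* (con 1 :+ con 19 :* t) := a :+ a :* (con 19 :* t)) refl (20 ^ s) t)
  ...   | inj₁ t<k = ≤-trans (*-monoʳ-≤ (20 ^ s) (begin
    1 + 19 * t   ≤⟨ +-monoˡ-≤ (19 * t) (s≤s (z≤n {18})) ⟩
    19 + 19 * t  ≡⟨ *-suc 19 t ⟨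
    19 * suc t   ≤⟨ *-monoʳ-≤ 19 t<k ⟩
    19 * k       ∎)) (m≤n+m _ _)
    where open ≤-Reasoning

  ^-distribʳ-* : ∀ a b n → (a * b) ^ n ≡ a ^ n * b ^ n
  ^-distribʳ-* a b zero = refl
  ^-distribʳ-* a b (suc n) rewrite ^-distribʳ-* a b n =
    solve 4 (λ a b x y → a :* b :* (x :* y) := a :* x :* (b :* y)) refl a b (a ^ n) (b ^ n)

  30^11n≤ : ∀ n → 30 ^ (11 * n) ≤ 2 ^ (11 * n) * 20 ^ (10 * n)
  30^11n≤ n = begin
    30 ^ (11 * n)                    ≡⟨ ^-*-assoc 30 11 n ⟨
    -- The ratio of the two bases is 20·(3/4)¹¹ < 1; 11 is the least exponent for which this holds.
    (30 ^ 11) ^ n                    ≤⟨ ^-monoˡ-≤ n (≤ᵇ⇒≤ (30 ^ 11) (2 ^ 11 * 20 ^ 10) _) ⟩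
    (2 ^ 11 * 20 ^ 10) ^ n           ≡⟨ ^-distribʳ-* (2 ^ 11) (20 ^ 10) n ⟩
    (2 ^ 11) ^ n * (20 ^ 10) ^ n     ≡⟨ cong₂ _*_ (^-*-assoc 2 11 n) (^-*-assoc 20 10 n) ⟩
    2 ^ (11 * n) * 20 ^ (10 * n)     ∎
    where open ≤-Reasoning

  -- Over the words of length 11n the mean of 20^(-m(w)) is at most 20^(-n). Averaging the linear
  -- bound of `weight-convex` at `t = n` then forces the mean of `m` to be at least n.
  sumM-11n-≥ : ∀ n → n * 2 ^ (11 * n) ≤ sumM (11 * n)
  sumM-11n-≥ n = *-cancelˡ-≤ 19 (*-cancelˡ-≤ s {{m^n≢0 20 (10 * n)}} (+-cancelˡ-≤ (q * s) _ _ (begin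
    q * s + s * (19 * (n * q))
      ≡⟨ solve 3 (λ q s n → q :* s :+ s :* (con 19 :* (n :* q)) := q :* (s :* (con 1 :+ con 19 :* n))) refl q s n ⟩
    q * (s * (1 + 19 * n))
      ≡⟨ ∑-const N _ ⟨
    ∑ N (λ _ → s * (1 + 19 * n))
      ≤⟨ ∑-mono N pointwise ⟩
    ∑ N (λ w → weight w + s * (19 * m w))
      ≡⟨ trans (∑-+ N weight _) (cong (∑ N weight +_) (trans (∑-* N s _) (cong (s *_) (∑-* N 19 m)))) ⟩
    ∑ N weight + s * (19 * sumM N)
      ≤⟨ +-monoˡ-≤ _ (≤-trans (∑weight≤ N) (30^11n≤ n)) ⟩
    q * s + s * (19 * sumM N) ∎)))
    where
    open ≤-Reasoning
    N = 11 * n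
    q = 2 ^ (11 * n)
    s = 20 ^ (10 * n)
    N≡ : 10 * n + n ≡ N
    N≡ = +-comm (10 * n) n
    pointwise : ∀ w → length w ≡ N → s * (1 + 19 * n) ≤ weight w + s * (19 * m w)
    pointwise w e = subst (λ z → s * (1 + 19 * n) ≤ 20 ^ (z ∸ m w) + s * (19 * m w)) len
      (weight-convex (10 * n) n (m w) (subst (m w ≤_) (sym len) (m≤length w)))
      where
      len : 10 * n + n ≡ length w
      len = trans N≡ (sym e)

  -- K̄(11n) ≤ 11·K̄(n) transfers the bound from multiples of 11 to every length.
  sumM-≥ : ∀ n → n * 2 ^ n ≤ 11 * sumM n
  sumM-≥ n = *-cancelˡ-≤ q {{m^n≢0 2 (11 * n)}} (begin
    q * (n * 2 ^ n)          ≡⟨ solve 3 (λ q n p → q :* (n :* p) := p :* (n :* q)) refl q n (2 ^ n) ⟩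
    2 ^ n * (n * q)          ≤⟨ *-monoʳ-≤ (2 ^ n) (sumM-11n-≥ n) ⟩
    2 ^ n * sumM (11 * n)    ≤⟨ sumM-multiple-≤ 11 n ⟩
    11 * (q * sumM n)        ≡⟨ solve 2 (λ q s → con 11 :* (q :* s) := q :* (con 11 :* s)) refl q (sumM n) ⟩
    q * (11 * sumM n)        ∎)
    where
    open ≤-Reasoning
    q = 2 ^ (11 * n)

  -- Computation of sumM by depth-first search over all words

  -- Each list comes from that of the tail without any palindrome test. The empty prefix is listed
  -- because wrapping it gives the two-letter palindromes.
  remainders : Word → List Word
  wrapped : Bool → List Word → List Word

  remainders [] = [ [] ]
  remainders (c ∷ s) = (c ∷ s) ∷ s ∷ wrapped c (remainders s)

  wrapped c [] = []
  wrapped c ([] ∷ L) = wrapped c L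
  wrapped false ((false ∷ t) ∷ L) = t ∷ wrapped false L
  wrapped false ((true ∷ t) ∷ L) = wrapped false L
  wrapped true ((false ∷ t) ∷ L) = wrapped true L
  wrapped true ((true ∷ t) ∷ L) = t ∷ wrapped true L

  ∈-wrapped⁻ : ∀ c L {t} → t ∈ wrapped c L → (c ∷ t) ∈ L
  ∈-wrapped⁻ c ([] ∷ L) t∈ = there (∈-wrapped⁻ c L t∈)
  ∈-wrapped⁻ false ((false ∷ _) ∷ L) (here refl) = here refl
  ∈-wrapped⁻ false ((false ∷ _) ∷ L) (there t∈) = there (∈-wrapped⁻ false L t∈)
  ∈-wrapped⁻ false ((true ∷ _) ∷ L) t∈ = there (∈-wrapped⁻ false L t∈)
  ∈-wrapped⁻ true ((false ∷ _) ∷ L) t∈ = there (∈-wrapped⁻ true L t∈)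
  ∈-wrapped⁻ true ((true ∷ _) ∷ L) (here refl) = here refl
  ∈-wrapped⁻ true ((true ∷ _) ∷ L) (there t∈) = there (∈-wrapped⁻ true L t∈)

  ∈-wrapped⁺ : ∀ c L {t} → (c ∷ t) ∈ L → t ∈ wrapped c L
  ∈-wrapped⁺ c ([] ∷ L) (there t∈) = ∈-wrapped⁺ c L t∈
  ∈-wrapped⁺ false ((false ∷ _) ∷ L) (here refl) = here refl
  ∈-wrapped⁺ false ((false ∷ _) ∷ L) (there t∈) = there (∈-wrapped⁺ false L t∈)
  ∈-wrapped⁺ false ((true ∷ _) ∷ L) (there t∈) = ∈-wrapped⁺ false L t∈
  ∈-wrapped⁺ true ((false ∷ _) ∷ L) (there t∈) = ∈-wrapped⁺ true L t∈
  ∈-wrapped⁺ true ((true ∷ _) ∷ L) (here refl) = here refl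
  ∈-wrapped⁺ true ((true ∷ _) ∷ L) (there t∈) = there (∈-wrapped⁺ true L t∈)

  remainders-sound : ∀ s {t} → t ∈ remainders s → ∃ λ p → IsPalindrome p × s ≡ p ++ t
  remainders-sound [] (here refl) = [] , refl , refl
  remainders-sound (c ∷ s) (here refl) = [] , refl , refl
  remainders-sound (c ∷ s) (there (here refl)) = [ c ] , refl , refl
  remainders-sound (c ∷ s) {t} (there (there t∈))
    with p , P , refl ← remainders-sound s (∈-wrapped⁻ c (remainders s) t∈) =
    c ∷ p ∷ʳ c , palindrome-wrap c P , cong (c ∷_) (sym (∷ʳ-++ p c t))

  palindrome-view : ∀ c p → IsPalindrome (c ∷ p) → p ≡ [] ⊎ ∃ λ q → IsPalindrome q × p ≡ q ∷ʳ c
  palindrome-view c p P with initLast p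
  ... | [] = inj₁ refl
  ... | q ∷ʳ′ y with refl , Q ← palindrome-unwrap c q y P = inj₂ (q , Q , refl)

  remainders-complete : ∀ p {t} → IsPalindrome p → t ∈ remainders (p ++ t)
  remainders-complete p = go (length p) p ≤-refl
    where
    -- The inner word `q` is not a structural part of `p`, so the recursion is on the bound `b`.
    go : ∀ b p {t} → length p ≤ b → IsPalindrome p → t ∈ remainders (p ++ t)
    go b [] {[]} _ _ = here refl
    go b [] {x ∷ t} _ _ = here refl
    go (suc b) (c ∷ p) {t} (s≤s p≤b) P with palindrome-view c p P
    ... | inj₁ refl = there (here refl)
    ... | inj₂ (q , Q , refl) = there (there (∈-wrapped⁺ c (remainders (q ∷ʳ c ++ t))
      (subst (λ w → (c ∷ t) ∈ remainders w) (sym (∷ʳ-++ q c t))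
        (go b q (≤-trans (length-++-≤ˡ q) p≤b) Q))))

  -- A word annotated at each letter with m of what follows that letter.
  data Annotated : Set where
    nil : Annotated
    cons : Bool → ℕ → Annotated → Annotated

  annotate : Word → Annotated
  annotate [] = nil
  annotate (x ∷ t) = cons x (m t) (annotate t)

  wrappedᵃ : Bool → List Annotated → List Annotated
  wrappedᵃ c [] = []
  wrappedᵃ c (nil ∷ L) = wrappedᵃ c L
  wrappedᵃ false (cons false k h ∷ L) = h ∷ wrappedᵃ false L
  wrappedᵃ false (cons true k h ∷ L) = wrappedᵃ false L
  wrappedᵃ true (cons false k h ∷ L) = wrappedᵃ true L
  wrappedᵃ true (cons true k h ∷ L) = h ∷ wrappedᵃ true L

  wrappedᵃ-annotate : ∀ c L → wrappedᵃ c (map annotate L) ≡ map annotate (wrapped c L)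
  wrappedᵃ-annotate c [] = refl
  wrappedᵃ-annotate c ([] ∷ L) = wrappedᵃ-annotate c L
  wrappedᵃ-annotate false ((false ∷ t) ∷ L) = cong (annotate t ∷_) (wrappedᵃ-annotate false L)
  wrappedᵃ-annotate false ((true ∷ t) ∷ L) = wrappedᵃ-annotate false L
  wrappedᵃ-annotate true ((false ∷ t) ∷ L) = wrappedᵃ-annotate true L
  wrappedᵃ-annotate true ((true ∷ t) ∷ L) = cong (annotate t ∷_) (wrappedᵃ-annotate true L)

  -- _⊓_ recurses on unary numerals; this version reduces to a built-in comparison.
  min : ℕ → ℕ → ℕ
  min a b = if a <ᵇ b then a else b

  min≡⊓ : ∀ a b → min a b ≡ a ⊓ b
  min≡⊓ a b = trans (lemma a b) (sym (⊓≡⊓′ a b))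
    where
    lemma : ∀ a b → min a b ≡ a ⊓′ b
    lemma a b with a <ᵇ b
    ... | false = refl
    ... | true = refl

  -- Only values stored in annotations are compared, so the search never evaluates `m`. The initial
  -- `a` will be `m s`, for what follows the prefix `[ c ]`.
  best : Bool → ℕ → List Annotated → ℕ
  best c a [] = a
  best c a (nil ∷ L) = best c a L
  best false a (cons false k h ∷ L) = best false (min a k) L
  best false a (cons true k h ∷ L) = best false a L
  best true a (cons false k h ∷ L) = best true a L
  best true a (cons true k h ∷ L) = best true (min a k) L

  minimum : ℕ → List ℕ → ℕ
  minimum a [] = a
  minimum a (k ∷ ks) = minimum (a ⊓ k) ks

  best≡minimum : ∀ c a L → best c a (map annotate L) ≡ minimum a (map m (wrapped c L))
  best≡minimum c a [] = refl
  best≡minimum c a ([] ∷ L) = best≡minimum c a L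
  best≡minimum false a ((false ∷ t) ∷ L) rewrite min≡⊓ a (m t) = best≡minimum false (a ⊓ m t) L
  best≡minimum false a ((true ∷ t) ∷ L) = best≡minimum false a L
  best≡minimum true a ((false ∷ t) ∷ L) = best≡minimum true a L
  best≡minimum true a ((true ∷ t) ∷ L) rewrite min≡⊓ a (m t) = best≡minimum true (a ⊓ m t) L

  minimum-≤-init : ∀ a ks → minimum a ks ≤ a
  minimum-≤-init a [] = ≤-refl
  minimum-≤-init a (k ∷ ks) = ≤-trans (minimum-≤-init (a ⊓ k) ks) (m⊓n≤m a k)

  minimum-≤ : ∀ a {k ks} → k ∈ ks → minimum a ks ≤ k
  minimum-≤ a {k} (here {xs = ks} refl) = ≤-trans (minimum-≤-init (a ⊓ k) ks) (m⊓n≤n a k)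
  minimum-≤ a (there k∈) = minimum-≤ (a ⊓ _) k∈

  minimum-≥ : ∀ {b} a ks → b ≤ a → (∀ {k} → k ∈ ks → b ≤ k) → b ≤ minimum a ks
  minimum-≥ a [] b≤a _ = b≤a
  minimum-≥ a (k ∷ ks) b≤a h = minimum-≥ (a ⊓ k) ks (⊓-glb b≤a (h (here refl))) (h ∘ there)

  -- The first palindrome of an optimal factorization is `[ c ]`, leaving `s`, or it wraps a
  -- palindromic prefix of `s`, leaving a member of `wrapped c (remainders s)`.
  m-∷ : ∀ c s → m (c ∷ s) ≡ suc (best c (m s) (map annotate (remainders s)))
  m-∷ c s = trans (≤-antisym lower (upper (m-attained (c ∷ s)) refl))
                  (cong suc (sym (best≡minimum c (m s) (remainders s))))
    where
    W : List Word
    W = wrapped c (remainders s)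
    lower : m (c ∷ s) ≤ suc (minimum (m s) (map m W))
    -- `pred` moves the successor to the left, so that `minimum-≥` can test each candidate
    -- separately.
    lower = ≤-pred-bound (minimum-≥ {pred (m (c ∷ s))} (m s) (map m W)
        (pred-mono-≤ (m-prepend-≤ [ c ] {s} refl))
        λ k∈ → case-∈ (∈-map⁻ m k∈))
      where
      ≤-pred-bound : ∀ {a b} → pred a ≤ b → a ≤ suc b
      ≤-pred-bound {zero} _ = z≤n
      ≤-pred-bound {suc a} a≤b = s≤s a≤b
      case-∈ : ∀ {k} → (∃ λ t → t ∈ W × k ≡ m t) → pred (m (c ∷ s)) ≤ k
      case-∈ (t , t∈ , refl) with remainders-sound (c ∷ s) (there (there t∈))
      ... | p , P , e = pred-mono-≤ (subst (λ w → m w ≤ suc (m t)) (sym e) (m-prepend-≤ p P))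
    upper : ∀ {w k} → PalFact w k → w ≡ c ∷ s → suc (minimum (m s) (map m W)) ≤ k
    upper (_∷_ {p = p} {t} P F) refl = s≤s (≤-trans (bound (palindrome-view c p P)) (m-minimal F))
      where
      bound : p ≡ [] ⊎ (∃ λ q → IsPalindrome q × p ≡ q ∷ʳ c) → minimum (m (p ++ t)) (map m (wrapped c (remainders (p ++ t)))) ≤ m t
      bound (inj₁ refl) = minimum-≤-init (m t) (map m (wrapped c (remainders t)))
      bound (inj₂ (q , Q , refl)) = minimum-≤ (m (q ∷ʳ c ++ t)) (∈-map⁺ m (∈-wrapped⁺ c _
        (subst (λ w → (c ∷ t) ∈ remainders w) (sym (∷ʳ-++ q c t)) (remainders-complete q Q))))

  -- visit is a separate function so that its arguments are shared during evaluation.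
  search : ℕ → Annotated → List Annotated → ℕ → ℕ
  visit : ℕ → Annotated → Annotated → List Annotated → ℕ → ℕ

  search zero h L k = k
  search (suc r) h L k =
    visit r (cons false k h) h (wrappedᵃ false L) (suc (best false k L)) +
    visit r (cons true k h) h (wrappedᵃ true L) (suc (best true k L))

  visit r h′ h L k = search r h′ (h′ ∷ h ∷ L) k

  -- The search invariant: the arguments describe the suffix `s` chosen so far, and `r` letters are
  -- still to be prepended. The next letter is the last of `v`, hence `∑-suc-∷ʳ`.
  search≡∑ : ∀ r s → search r (annotate s) (map annotate (remainders s)) (m s) ≡ ∑ r (λ v → m (v ++ s))
  search≡∑ zero s = sym (+-identityʳ (m s))
  search≡∑ (suc r) s = trans (cong₂ _+_ (branch false) (branch true)) (sym (∑-suc-∷ʳ r (λ v → m (v ++ s))))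
    where
    branch : ∀ c → visit r (annotate (c ∷ s)) (annotate s) (wrappedᵃ c (map annotate (remainders s)))
                     (suc (best c (m s) (map annotate (remainders s))))
                 ≡ ∑ r (λ v → m (v ∷ʳ c ++ s))
    branch c rewrite sym (m-∷ c s) | wrappedᵃ-annotate c (remainders s) =
      trans (search≡∑ r (c ∷ s)) (∑-cong r λ v → cong m (sym (∷ʳ-++ v c s)))

  search≡sumM : ∀ n → search n nil [ nil ] 0 ≡ sumM n
  search≡sumM n = trans (search≡∑ n []) (∑-cong n λ v → cong m (++-identityʳ v))

  -- Passage to rational numbers

  /-≤-/+/ : ∀ a b c d e f .{{_ : NonZero b}} .{{_ : NonZero d}} .{{_ : NonZero f}} →
    a * (d * f) ≤ (c * f + e * d) * b → ((ℤ.+ a) / b) ℚ.≤ ((ℤ.+ c) / d) ℚ.+ ((ℤ.+ e) / f)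
  -- `_/_` cancels common factors; for unnormalised fractions the claim is the cross-multiplied
  -- inequality.
  /-≤-/+/ a (suc b) c (suc d) e (suc f) le = ℚ.toℚᵘ-cancel-≤ (begin
    toℚᵘ ((ℤ.+ a) / suc b)                                     ≃⟨ ℚ.toℚᵘ-fromℚᵘ (mkℚᵘ (ℤ.+ a) b) ⟩
    mkℚᵘ (ℤ.+ a) b                                             ≤⟨ *≤* int ⟩
    mkℚᵘ (ℤ.+ c) d ℚᵘ.+ mkℚᵘ (ℤ.+ e) f
      ≃⟨ ℚᵘ.+-cong (ℚ.toℚᵘ-fromℚᵘ (mkℚᵘ (ℤ.+ c) d)) (ℚ.toℚᵘ-fromℚᵘ (mkℚᵘ (ℤ.+ e) f)) ⟨
    toℚᵘ ((ℤ.+ c) / suc d) ℚᵘ.+ toℚᵘ ((ℤ.+ e) / suc f)           ≃⟨ ℚ.toℚᵘ-homo-+ ((ℤ.+ c) / suc d) ((ℤ.+ e) / suc f) ⟨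
    toℚᵘ (((ℤ.+ c) / suc d) ℚ.+ ((ℤ.+ e) / suc f))               ∎)
    where
    open ℚᵘ.≤-Reasoning
    int : ℤ.+ a ℤ.* ℤ.+ (suc d * suc f) ℤ.≤ (ℤ.+ c ℤ.* ℤ.+ suc f ℤ.+ ℤ.+ e ℤ.* ℤ.+ suc d) ℤ.* ℤ.+ suc b
    int = subst₂ ℤ._≤_ (ℤ.pos-* a (suc d * suc f))
      (trans (ℤ.pos-* (c * suc f + e * suc d) (suc b))
        (cong (ℤ._* ℤ.+ suc b) (cong₂ ℤ._+_ (ℤ.pos-* c (suc f)) (ℤ.pos-* e (suc d)))))
      (ℤ.+≤+ le)

  -- The variable `s` lets a numeral replace `sumM n` before the fraction is reduced.
  Kratio≡ : ∀ n .{{_ : NonZero n}} {s} → sumM n ≡ s →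
    Kratio n ≡ ((ℤ.+ s) / (n * 2 ^ n)) {{m*n≢0 n (2 ^ n) {{it}} {{m^n≢0 2 n}}}}
  Kratio≡ n refl = refl

  Kratio-compare : ∀ n k .{{_ : NonZero n}} .{{_ : NonZero k}} p q .{{_ : NonZero q}} →
    288 * q ≤ p * n → Kratio n ℚ.≤ Kratio k ℚ.+ ((ℤ.+ p) / q)
  Kratio-compare n k p q le = /-≤-/+/ (sumM n) (n * N) (sumM k) (k * K) p q
    {{m*n≢0 n N {{it}} {{m^n≢0 2 n}}}} {{m*n≢0 k K {{it}} {{m^n≢0 2 k}}}} (begin
    sumM n * (k * K * q)
      ≡⟨ solve 4 (λ s k K q → s :* (k :* K :* q) := q :* (k :* K :* s)) refl (sumM n) k K q ⟩
    q * (k * K * sumM n)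
      ≤⟨ *-monoʳ-≤ q (sumM-compare n k) ⟩
    q * (N * (n * sumM k + 288 * (k * K)))
      ≡⟨ solve 5 (λ q N n s c → q :* (N :* (n :* s :+ con 288 :* c)) := N :* (n :* s :* q :+ (con 288 :* q) :* c)) refl q N n (sumM k) (k * K) ⟩
    N * (n * sumM k * q + 288 * q * (k * K))
      ≤⟨ *-monoʳ-≤ N (+-monoʳ-≤ (n * sumM k * q) (*-monoˡ-≤ (k * K) le)) ⟩
    N * (n * sumM k * q + p * n * (k * K))
      ≡⟨ solve 6 (λ N n s q p c → N :* (n :* s :* q :+ p :* n :* c) := (s :* q :+ p :* c) :* (n :* N)) refl N n (sumM k) q p (k * K) ⟩
    (sumM k * q + p * (k * K)) * (n * N) ∎)
    where
    open ≤-Reasoning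
    N = 2 ^ n
    K = 2 ^ k

  -- With `k` arbitrary, the tail of `Kratio` lies within `ε` of its infimum, so the limit exists
  -- and equals the infimum.
  Kratio-limit : ∀ (ε : ℚ) → 0ℚ ℚ.< ε → ∃ λ (N : ℕ) →
    ∀ (n : ℕ) .{{_ : NonZero n}} → n ≥ N →
    ∀ (k : ℕ) .{{_ : NonZero k}} → Kratio n ℚ.≤ Kratio k ℚ.+ ε
  -- The numerator is at least 1, so `ε` is at least 1/(q + 1), and 288/n ≤ `ε` once n ≥ 288(q + 1).
  Kratio-limit ε@(mkℚ (ℤ.+ suc p) q _) _ = 288 * suc q , λ n n≥N k →
    subst (λ z → Kratio n ℚ.≤ Kratio k ℚ.+ z) (ℚ.↥p/↧p≡p ε)
      (Kratio-compare n k (suc p) (suc q) (≤-trans n≥N (m≤m+n n (p * n))))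
  Kratio-limit (mkℚ (ℤ.+ zero) _ _) (ℚ.*<* (ℤ.+<+ ()))
  Kratio-limit (mkℚ -[1+ _ ] _ _) (ℚ.*<* ())

  -- The margin 1/1000 keeps the inequality strict in the limit; 0.08881 is still below 1/11.
  Kratio-≥ : ∀ n .{{_ : NonZero n}} → ((ℤ.+ 8781) / 100000) ℚ.+ ((ℤ.+ 1) / 1000) ℚ.≤ Kratio n
  Kratio-≥ n = ℚ.≤-trans (/-≤-/+/ 8881 100000 (sumM n) (n * 2 ^ n) 0 1 {{_}} {{m*n≢0 n (2 ^ n) {{it}} {{m^n≢0 2 n}}}} (begin
    8881 * (n * 2 ^ n * 1)
      ≤⟨ *-monoʳ-≤ 8881 (≤-trans (≤-reflexive (*-identityʳ (n * 2 ^ n))) (sumM-≥ n)) ⟩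
    8881 * (11 * sumM n)
      -- 2309 = 100000 - 11 · 8881.
      ≤⟨ m≤m+n _ (2309 * sumM n) ⟩
    8881 * (11 * sumM n) + 2309 * sumM n
      ≡⟨ solve 1 (λ s → con 8881 :* (con 11 :* s) :+ con 2309 :* s := (s :* con 1 :+ con 0) :* con 100000) refl (sumM n) ⟩
    (sumM n * 1 + 0) * 100000 ∎)) (ℚ.≤-reflexive (ℚ.+-identityʳ (Kratio n)))
    where open ≤-Reasoning

  sumM-21 : sumM 21 ≡ 8939688
  sumM-21 = trans (sym (search≡sumM 21)) search-21
    where
    search-21 : search 21 nil [ nil ] 0 ≡ 8939688
    -- Evaluation of the search over all 2²¹ words.
    search-21 = refl

  Kratio-21 : Kratio 21 ≡ (ℤ.+ 372487) / (7 * 2 ^ 18)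
  -- The fractions agree after cancelling 24: 8939688 = 24 · 372487 and 21 · 2²¹ = 24 · 7 · 2¹⁸.
  Kratio-21 = trans (Kratio≡ 21 sumM-21) refl

open import Data.Integer using (+_)
open PalindromicLength using (Kratio-limit; Kratio-≥; Kratio-21)
open import Data.Rational using (_+_; _≤_; _<_)
open import Data.Rational.Properties using (positive⁻¹)

theorem2 : (∀ (ε : ℚ) → 0ℚ < ε → ∃ λ (N : ℕ) →
    ∀ (n : ℕ) .{{_ : NonZero n}} → n ≥ N →
    ∀ (k : ℕ) .{{_ : NonZero k}} → Kratio n ≤ Kratio k + ε)
    × (∃ λ (δ : ℚ) → 0ℚ < δ × (∀ (n : ℕ) .{{_ : NonZero n}} →
    (+ 8781) / 100000 + δ ≤ Kratio n))
    × (Kratio 21 ≡ (+ 372487) / (7 * 2 ^ 18))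
theorem2 = Kratio-limit , ((+ 1) / 1000 , positive⁻¹ ((+ 1) / 1000) , λ n → Kratio-≥ n) , Kratio-21
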